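{- For every class of graphs $\mathcal{C}$ with bounded expansion and every $d\in\mathbb{N}$, there exists a constant $c\in\mathbb{N}$ such that $$\frac{1}{c}\cdot\mathrm{col}(H)\leq\omega(H)\leq\chi(H)\leq\mathrm{col}(H)\qquad\text{for all } H\in\overline{\mathcal{C}^d}.$$
   Context: All graphs are finite, simple and undirected. $G^d$ is the graph on $V(G)$ where distinct $u,v$ are adjacent iff their distance in $G$ is at most $d$; $\mathcal{C}^d=\{G^d:G\in\mathcal{C}\}$; $\overline{\mathcal{D}}$ denotes the hereditary closure of a class $\mathcal{D}$, i.e. all induced subgraphs of graphs in $\mathcal{D}$. $\omega(H)$ is the clique number and $\chi(H)$ the chromatic number. For a vertex ordering $\sigma$ of $H$, $\mathrm{col}(H,\sigma)=1+\max_{u}|\{v: uv\in E(H),\ v<_\sigma u\}|$, and the coloring number $\mathrm{col}(H)$ is the minimum of $\mathrm{col}(H,\sigma)$ over all vertex orderings. A graph is a depth-$r$ minor of $G$ if it is obtained from a subgraph of $G$ by contracting pairwise disjoint connected subgraphs of radius at most $r$; a class $\mathcal{C}$ has bounded expansion if for every $r\in\mathbb{N}$ the ratio of edges to vertices of depth-$r$ minors of graphs in $\mathcal{C}$ is bounded. -}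

module Defs where

open import Data.Nat using (ℕ; zero; suc; _≤_; _*_; _<ᵇ_)
open import Data.Bool using (Bool; true; false; _∧_; _∨_; not)
open import Data.Fin using (Fin; toℕ; _≟_)
open import Data.List using (List; length; filterᵇ; map)
open import Data.Bool.ListAction using (any)
open import Data.Nat.ListAction using (sum)
open import Data.List using (allFin)
open import Data.Maybe using (Maybe; just; nothing)
open import Data.Product using (Σ; ∃; _×_)
open import Relation.Binary.PropositionalEquality using (_≡_; _≢_)
open import Relation.Nullary.Decidable using (⌊_⌋)
open import Function.Definitions using (Injective)

-- A finite simple graph on vertex set Fin n.  The raw relation `edge` is
-- arbitrary; the adjacency relation is its symmetrisation with the diagonal
-- removed, so every Graph is simple and undirected, and every finite simple
-- graph arises (up to isomorphism) this way.
record Graph : Set where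
  field
    n    : ℕ
    edge : Fin n → Fin n → Bool

open Graph public

eqᵇ : ∀ {n} → Fin n → Fin n → Bool
eqᵇ u v = ⌊ u ≟ v ⌋

adj : (G : Graph) → Fin (n G) → Fin (n G) → Bool
adj G u v = not (eqᵇ u v) ∧ (edge G u v ∨ edge G v u)

Adj : (G : Graph) → Fin (n G) → Fin (n G) → Set
Adj G u v = adj G u v ≡ true

count : ∀ {m} → (Fin m → Bool) → ℕ
count {m} p = length (filterᵇ p (allFin m))

-- reachInB G P k u v : there is a walk of length ≤ k from u to v in G
-- all of whose vertices other than u lie in P (u itself is v when k = 0,
-- and in uses below u is always in P).
reachInB : (G : Graph) → (Fin (n G) → Bool) → ℕ → Fin (n G) → Fin (n G) → Bool
reachInB G P zero    u v = eqᵇ u v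
reachInB G P (suc k) u v =
  reachInB G P k u v ∨ any (λ w → adj G u w ∧ P w ∧ reachInB G P k w v) (allFin (n G))

distLe : (G : Graph) → ℕ → Fin (n G) → Fin (n G) → Bool
distLe G k u v = reachInB G (λ _ → true) k u v

power : Graph → ℕ → Graph
power G d = record { n = n G ; edge = distLe G d }

InducedSub : Graph → Graph → Set
InducedSub H G =
  Σ (Fin (n H) → Fin (n G)) λ f →
    Injective _≡_ _≡_ f × (∀ u v → adj H u v ≡ adj G (f u) (f v))

Class : Set₁
Class = Graph → Set

HerPow : Class → ℕ → Class
HerPow C d H = Σ Graph λ G → C G × InducedSub H (power G d)

numEdges : Graph → ℕ
numEdges G = sum (map (λ u → count {n G} (λ v → adj G u v ∧ (toℕ v <ᵇ toℕ u))) (allFin (n G)))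

-- M is a depth-r minor of G: there are pairwise disjoint branch sets
-- B_i = β⁻¹(just i) (i ∈ V(M)), each containing a centre c i such that every
-- vertex of B_i is reachable from c i by a path of length ≤ r inside G[B_i]
-- (so B_i is connected of radius ≤ r), and every edge ij of M is realised by
-- an edge of G between B_i and B_j.
inBranch : ∀ {n m} → (Fin n → Maybe (Fin m)) → Fin m → Fin n → Bool
inBranch β i v with β v
... | just j  = eqᵇ i j
... | nothing = false

DepthMinor : ℕ → Graph → Graph → Set
DepthMinor r M G =
  Σ (Fin (n G) → Maybe (Fin (n M))) λ β →
  Σ (Fin (n M) → Fin (n G)) λ c →
    (∀ i → β (c i) ≡ just i)
    × (∀ i v → β v ≡ just i → reachInB G (inBranch β i) r (c i) v ≡ true)
    × (∀ i j → Adj M i j →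
         ∃ λ u → ∃ λ v → β u ≡ just i × β v ≡ just j × Adj G u v)

BoundedExpansion : Class → Set
BoundedExpansion C =
  ∀ (r : ℕ) → ∃ λ (b : ℕ) → ∀ G → C G → ∀ M → DepthMinor r M G → numEdges M ≤ b * n M

HasClique : Graph → ℕ → Set
HasClique H k = Σ (Fin k → Fin (n H)) λ f → ∀ i j → i ≢ j → Adj H (f i) (f j)

IsCliqueNumber : Graph → ℕ → Set
IsCliqueNumber H k = HasClique H k × (∀ j → HasClique H j → j ≤ k)

Colorable : Graph → ℕ → Set
Colorable H k = Σ (Fin (n H) → Fin k) λ col → ∀ u v → Adj H u v → col u ≢ col v

IsChromaticNumber : Graph → ℕ → Set
IsChromaticNumber H k = Colorable H k × (∀ j → Colorable H j → k ≤ j)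

-- coloring number.  A vertex ordering is an injective σ : V → Fin |V|
-- (σ u is the position of u); v <σ u iff σ v < σ u.
backDeg : (H : Graph) → (Fin (n H) → Fin (n H)) → Fin (n H) → ℕ
backDeg H σ u = count {n H} (λ v → adj H u v ∧ (toℕ (σ v) <ᵇ toℕ (σ u)))

-- col(H,σ) ≤ k, where col(H,σ) = 1 + max_u backDeg (max over ∅ taken so that
-- the empty graph has col(H,σ) = 0)
ColLe : (H : Graph) → (Fin (n H) → Fin (n H)) → ℕ → Set
ColLe H σ k = ∀ u → suc (backDeg H σ u) ≤ k

IsColoringNumber : Graph → ℕ → Set
IsColoringNumber H k =
  (Σ (Fin (n H) → Fin (n H)) λ σ → Injective _≡_ _≡_ σ × ColLe H σ k)
  × (∀ j → (σ : Fin (n H) → Fin (n H)) → Injective _≡_ _≡_ σ → ColLe H σ j → k ≤ j)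

{-# OPTIONS --safe #-}
-- Let ρ = ⌊d/2⌋ and let H be induced in G^d by a vertex set A.  A ball of radius ρ
-- meets A in a clique of H, hence in at most ω vertices.  For S ⊆ A, the Voronoi
-- cells of radius ρ around S span a depth-ρ minor of G, in which two vertices u, v
-- of S adjacent in H are adjacent unless another vertex of S comes within ρ of a
-- chosen walk of length at most d from u to v.  At most (d+1) ω vertices of A can
-- interfere like this, so a random S of density 1 / (2 (d+1) ω) keeps half of its
-- pairs, and comparison with the edge density b of the minors gives H average
-- degree O(b d ω).  This holds for all induced subgraphs of H, so H is degenerate.
module Submission where

open import Defs
open import Data.Nat using (ℕ; _≤_; _*_)
open import Data.Product using (∃; _×_)

open import Data.Nat.Properties renaming (_≟_ to _≟ℕ_)
open import Algebra.Properties.Semiring.Sum +-*-semiring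
  using (sum; sum-cong-≗; ∑-distrib-+; ∑-comm; sum-remove; *-distribˡ-sum; *-distribʳ-sum)
open import Data.Bool using (Bool; true; false; _∧_; _∨_; not)
open import Data.Bool.ListAction using (any)
import Data.Bool.Properties as Bool
open import Data.Fin using (Fin; zero; suc; toℕ; _≟_; punchIn; punchOut; inject₁; fromℕ; fromℕ<)
open import Data.Fin.Properties
  using (any?; injective⇒≤; toℕ-injective; toℕ<n; toℕ-fromℕ; toℕ-inject₁; inject₁-injective; fromℕ≢inject₁;
         punchIn-injective; punchInᵢ≢i; punchIn-punchOut; punchOut-punchIn; punchOut-cong)
  renaming (suc-injective to Fin-suc-injective)
open import Data.List using (List; []; _∷_; length; map; filterᵇ; allFin; tabulate)
open import Data.List.Membership.Propositional using (lose)
open import Data.List.Membership.Propositional.Properties using (∈-allFin)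
open import Data.List.Relation.Unary.All as All using (All; []; _∷_)
open import Data.List.Relation.Unary.AllPairs using ([]; _∷_)
import Data.List.Relation.Unary.Any as Any
import Data.List.Relation.Unary.Any.Properties as Any
open import Data.List.Relation.Unary.Unique.Propositional using (Unique)
open import Data.Maybe using (Maybe; just; nothing; _<∣>_)
open import Data.Maybe.Properties using (just-injective; ≡-dec)
open import Data.Nat using (zero; suc; _+_; _^_; _<_; _<ᵇ_; _≤?_; z≤n; s≤s; ⌊_/2⌋; >-nonZero)
import Data.Nat.ListAction as List
open import Data.Nat.Solver using (module +-*-Solver)
open import Data.Product using (_,_; proj₁; proj₂)
open import Data.Sum as Sum using (_⊎_; inj₁; inj₂)
import Data.Vec.Functional as Vector
open import Function using (_∘_; id; const; Equivalence)
open import Function.Definitions using (Injective)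
open import Relation.Binary.Definitions using (tri<; tri≈; tri>)
open import Relation.Binary.PropositionalEquality
  using (_≡_; _≢_; refl; sym; trans; cong; cong₂; subst; module ≡-Reasoning)
open import Relation.Nullary using (Dec; yes; no; contradiction)
open import Relation.Nullary.Decidable using (⌊_⌋; toWitness; fromWitness; _×-dec_; ¬?; decidable-stable)
open import Relation.Unary using (Decidable)

-- Indicators of Boolean conditions

𝟙 : Bool → ℕ
𝟙 true  = 1
𝟙 false = 0

𝟙≤1 : ∀ b → 𝟙 b ≤ 1
𝟙≤1 true  = ≤-refl
𝟙≤1 false = z≤n

𝟙-mono : ∀ {a b} → (a ≡ true → b ≡ true) → 𝟙 a ≤ 𝟙 b
𝟙-mono {false} _   = z≤n
𝟙-mono {true}  a⇒b = ≤-reflexive (cong 𝟙 (sym (a⇒b refl)))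

𝟙-∧≤ : ∀ a b → 𝟙 (a ∧ b) ≤ 𝟙 a
𝟙-∧≤ true  b = 𝟙≤1 b
𝟙-∧≤ false b = z≤n

-- Finite sums

sum-mono : ∀ {m} {f g : Fin m → ℕ} → (∀ i → f i ≤ g i) → sum f ≤ sum g
sum-mono {zero}  f≤g = z≤n
sum-mono {suc m} f≤g = +-mono-≤ (f≤g zero) (sum-mono (f≤g ∘ suc))

term≤sum : ∀ {m} (f : Fin m → ℕ) i → f i ≤ sum f
term≤sum f zero    = m≤m+n _ _
term≤sum f (suc i) = ≤-trans (term≤sum (f ∘ suc) i) (m≤n+m _ _)

sum-const : ∀ m c → sum {m} (const c) ≡ m * c
sum-const zero    c = refl
sum-const (suc m) c = cong (c +_) (sum-const m c)

sum-0 : ∀ {m} {f : Fin m → ℕ} → (∀ i → f i ≡ 0) → sum f ≡ 0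
sum-0 {m} f≡0 = trans (sum-cong-≗ f≡0) (trans (sum-const m 0) (*-zeroʳ m))

sum≡0 : ∀ {m} (f : Fin m → ℕ) → sum f ≡ 0 → ∀ i → f i ≡ 0
sum≡0 f eq i = n≤0⇒n≡0 (≤-trans (term≤sum f i) (≤-reflexive eq))

-- When the first value exceeds `c`, dropping it together with one `c` from the bound leaves the
-- same hypothesis for the remaining values.
minimum≤mean : ∀ {m} (f : Fin (suc m) → ℕ) c → sum f ≤ suc m * c → ∃ λ i → f i ≤ c
minimum≤mean f c le with f zero ≤? c
... | yes f₀≤c = zero , f₀≤c
minimum≤mean {zero}  f c le | no f₀≰c =
  contradiction (+-cancelʳ-≤ 0 _ _ le) f₀≰c
minimum≤mean {suc m} f c le | no f₀≰c
  with minimum≤mean (f ∘ suc) c (+-cancelˡ-≤ c _ _ (≤-trans (+-monoˡ-≤ _ (<⇒≤ (≰⇒> f₀≰c))) le))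
... | i , fᵢ≤c = suc i , fᵢ≤c

length-filter-tabulate : ∀ {m} {A : Set} (p : A → Bool) (f : Fin m → A) →
                         length (filterᵇ p (tabulate f)) ≡ sum (𝟙 ∘ p ∘ f)
length-filter-tabulate {zero}  p f = refl
length-filter-tabulate {suc m} p f with p (f zero)
... | true  = cong suc (length-filter-tabulate p (f ∘ suc))
... | false = length-filter-tabulate p (f ∘ suc)

count≡sum : ∀ {m} (p : Fin m → Bool) → count p ≡ sum (𝟙 ∘ p)
count≡sum p = length-filter-tabulate p id

-- Exchanging the order of summation gives `b` and its transpose the same total, so a pair may be
-- counted in just one of its two orders.
sum-sum-symmetric : ∀ {m} (a b : Fin m → Fin m → ℕ) → (∀ i j → a i j ≤ b i j + b j i) →
                    sum (λ i → sum (a i)) ≤ 2 * sum (λ i → sum (b i))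
sum-sum-symmetric a b a≤b+bᵀ = begin
  sum (λ i → sum (a i))                          ≤⟨ sum-mono (λ i → sum-mono (a≤b+bᵀ i)) ⟩
  sum (λ i → sum λ j → b i j + b j i)            ≡⟨ sum-cong-≗ (λ i → ∑-distrib-+ (b i) (λ j → b j i)) ⟩
  sum (λ i → sum (b i) + sum λ j → b j i)        ≡⟨ ∑-distrib-+ (λ i → sum (b i)) (λ i → sum λ j → b j i) ⟩
  sum (λ i → sum (b i)) + sum (λ i → sum λ j → b j i)
    ≡⟨ cong (sum (λ i → sum (b i)) +_) (∑-comm (λ i j → b j i)) ⟩
  sum (λ i → sum (b i)) + sum (λ i → sum (b i))  ≡⟨ cong (sum (λ i → sum (b i)) +_) (+-identityʳ _) ⟨
  2 * sum (λ i → sum (b i))                      ∎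
  where open ≤-Reasoning

sum-map-tabulate : ∀ {m} {A : Set} (h : A → ℕ) (f : Fin m → A) →
                   List.sum (map h (tabulate f)) ≡ sum (h ∘ f)
sum-map-tabulate {zero}  h f = refl
sum-map-tabulate {suc m} h f = cong (h (f zero) +_) (sum-map-tabulate h (f ∘ suc))

-- Enumerations of decidable subsets

-- Vertex sets of cliques and minors have to be of the form `Fin k`; an enumeration gives a subset
-- this form, and `sum-elem` carries sums back to the ambient set.
record Enumeration {m} (S : Fin m → Bool) : Set where
  field
    size      : ℕ
    elem      : Fin size → Fin m
    injective : Injective _≡_ _≡_ elem
    sound     : ∀ i → S (elem i) ≡ true
    complete  : ∀ {u} → S u ≡ true → ∃ λ i → elem i ≡ u
    sum-elem  : ∀ (h : Fin m → ℕ) → sum (h ∘ elem) ≡ sum (λ u → h u * 𝟙 (S u))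

  size≡sum : size ≡ sum (𝟙 ∘ S)
  size≡sum = trans (sym (*-identityʳ size)) (trans (sym (sum-const size 1))
    (trans (sum-elem (const 1)) (sum-cong-≗ λ u → *-identityˡ (𝟙 (S u)))))

enumerate : ∀ {m} (S : Fin m → Bool) → Enumeration S
enumerate {zero}  S = record
  { size = 0 ; elem = λ () ; injective = λ {} ; sound = λ ()
  ; complete = λ { {()} } ; sum-elem = λ _ → refl }
enumerate {suc m} S with S zero in S₀
... | false = record
  { size      = size
  ; elem      = suc ∘ elem
  ; injective = injective ∘ Fin-suc-injective
  ; sound     = sound
  ; complete  = λ { {zero} S₀′ → contradiction (trans (sym S₀) S₀′) λ ()
                  ; {suc u} Sᵤ → let i , eq = complete Sᵤ in i , cong suc eq }
  ; sum-elem  = λ h → trans (sum-elem (h ∘ suc))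
      (cong (_+ sum (λ u → h (suc u) * 𝟙 (S (suc u)))) (sym (trans (cong (λ b → h zero * 𝟙 b) S₀) (*-zeroʳ (h zero)))))
  }
  where open Enumeration (enumerate (S ∘ suc))
... | true = record
  { size      = suc size
  ; elem      = elem⁺
  ; injective = injective⁺
  ; sound     = λ { zero → S₀ ; (suc i) → sound i }
  ; complete  = λ { {zero} _ → zero , refl
                  ; {suc u} Sᵤ → let i , eq = complete Sᵤ in suc i , cong suc eq }
  ; sum-elem  = λ h → cong₂ _+_
      (sym (trans (cong (λ b → h zero * 𝟙 b) S₀) (*-identityʳ (h zero)))) (sum-elem (h ∘ suc))
  }
  where
  open Enumeration (enumerate (S ∘ suc))
  elem⁺ : Fin (suc size) → Fin (suc m)
  elem⁺ zero    = zero
  elem⁺ (suc i) = suc (elem i)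
  injective⁺ : Injective _≡_ _≡_ elem⁺
  injective⁺ {zero}  {zero}  _  = refl
  injective⁺ {suc i} {suc j} eq = cong suc (injective (Fin-suc-injective eq))

-- Random subsets

-- The expectation of g over the random subset that contains each element
-- independently with probability 1 / (1 + p), scaled by (1 + p) ^ m.
𝔼 : ℕ → ∀ {m} → ((Fin m → Bool) → ℕ) → ℕ
𝔼 p {zero}  g = g λ ()
𝔼 p {suc m} g = p * 𝔼 p (g ∘ (false Vector.∷_)) + 𝔼 p (g ∘ (true Vector.∷_))

module _ (p : ℕ) where

  𝔼-mono : ∀ {m} {g h : (Fin m → Bool) → ℕ} → (∀ S → g S ≤ h S) → 𝔼 p g ≤ 𝔼 p h
  𝔼-mono {zero}  g≤h = g≤h _
  𝔼-mono {suc m} g≤h = +-mono-≤ (*-monoʳ-≤ p (𝔼-mono λ S → g≤h (false Vector.∷ S))) (𝔼-mono λ S → g≤h (true Vector.∷ S))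

  𝔼-cong : ∀ {m} {g h : (Fin m → Bool) → ℕ} → (∀ S → g S ≡ h S) → 𝔼 p g ≡ 𝔼 p h
  𝔼-cong g≡h = ≤-antisym (𝔼-mono (≤-reflexive ∘ g≡h)) (𝔼-mono (≤-reflexive ∘ sym ∘ g≡h))

  𝔼-+ : ∀ {m} (g h : (Fin m → Bool) → ℕ) → 𝔼 p (λ S → g S + h S) ≡ 𝔼 p g + 𝔼 p h
  𝔼-+ {zero}  g h = refl
  𝔼-+ {suc m} g h = trans
    (cong₂ (λ x y → p * x + y) (𝔼-+ (g ∘ (false Vector.∷_)) (h ∘ (false Vector.∷_)))
      (𝔼-+ (g ∘ (true Vector.∷_)) (h ∘ (true Vector.∷_))))
    (solve 5 (λ p a b c d → p :* (a :+ b) :+ (c :+ d) := (p :* a :+ c) :+ (p :* b :+ d)) refl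
      p (𝔼 p (g ∘ (false Vector.∷_))) _ (𝔼 p (g ∘ (true Vector.∷_))) _)
    where open +-*-Solver

  𝔼-* : ∀ {m} c (g : (Fin m → Bool) → ℕ) → 𝔼 p (λ S → c * g S) ≡ c * 𝔼 p g
  𝔼-* {zero}  c g = refl
  𝔼-* {suc m} c g = trans
    (cong₂ (λ x y → p * x + y) (𝔼-* c (g ∘ (false Vector.∷_))) (𝔼-* c (g ∘ (true Vector.∷_))))
    (solve 4 (λ p a b c → p :* (c :* a) :+ c :* b := c :* (p :* a :+ b)) refl
      p (𝔼 p (g ∘ (false Vector.∷_))) (𝔼 p (g ∘ (true Vector.∷_))) c)
    where open +-*-Solver

  𝔼-sum : ∀ {m k} (g : Fin k → (Fin m → Bool) → ℕ) →
          𝔼 p (λ S → sum λ i → g i S) ≡ sum λ i → 𝔼 p (g i)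
  𝔼-sum {m} {zero}  g = 𝔼-* {m} 0 (const 0)
  𝔼-sum {m} {suc k} g = trans (𝔼-+ (g zero) _) (cong (𝔼 p (g zero) +_) (𝔼-sum (g ∘ suc)))

  -- The event that `w` is sampled has probability `1 / (1 + p)` and is independent of `g`, whose
  -- value ignores the membership of `w`.
  𝔼-pick : ∀ {m} (w : Fin m) (g : (Fin m → Bool) → ℕ) →
           (∀ S S′ → (∀ i → w ≢ i → S i ≡ S′ i) → g S ≡ g S′) →
           suc p * 𝔼 p (λ S → 𝟙 (S w) * g S) ≡ 𝔼 p g
  𝔼-pick {suc m} zero g indep = trans
    (cong₂ (λ x y → suc p * (p * x + y)) (𝔼-* {m} 0 (const 0)) (𝔼-* {m} 1 (g ∘ (true Vector.∷_))))
    (trans (solve 2 (λ p a → (con 1 :+ p) :* (p :* con 0 :+ con 1 :* a) := p :* a :+ a) refl p 𝔼₁)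
      (cong (λ x → p * x + 𝔼₁) (𝔼-cong λ S → indep (true Vector.∷ S) (false Vector.∷ S) λ
        { zero 0≢0 → contradiction refl 0≢0 ; (suc i) _ → refl })))
    where
    open +-*-Solver
    𝔼₁ = 𝔼 p (g ∘ (true Vector.∷_))
  𝔼-pick {suc m} (suc w) g indep = trans
    (solve 3 (λ p a b → (con 1 :+ p) :* (p :* a :+ b) := p :* ((con 1 :+ p) :* a) :+ (con 1 :+ p) :* b)
      refl p (𝔼 p (λ S → 𝟙 (S w) * g (false Vector.∷ S))) _)
    (cong₂ (λ x y → p * x + y) (step false) (step true))
    where
    open +-*-Solver
    step : ∀ b → suc p * 𝔼 p (λ S → 𝟙 (S w) * g (b Vector.∷ S)) ≡ 𝔼 p (g ∘ (b Vector.∷_))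
    step b = 𝔼-pick w _ λ S S′ eq → indep _ _ λ
      { zero _ → refl ; (suc i) w≢i → eq i (w≢i ∘ cong suc) }

-- An indicator written as a product over a list, so that vertices, pairs and triples of the sample
-- are handled alike.
contains : ∀ {m} → List (Fin m) → (Fin m → Bool) → ℕ
contains []       S = 1
contains (u ∷ us) S = 𝟙 (S u) * contains us S

contains-local : ∀ {m} {w : Fin m} us → All (w ≢_) us → ∀ S S′ →
                 (∀ i → w ≢ i → S i ≡ S′ i) → contains us S ≡ contains us S′
contains-local []       []           S S′ eq = refl
contains-local (u ∷ us) (w≢u ∷ w∉us) S S′ eq =
  cong₂ (λ b x → 𝟙 b * x) (eq u w≢u) (contains-local us w∉us S S′ eq)

-- Each use trades one summation over the sample for one over the whole ground set, at the cost of
-- one more factor in the indicator; nested sums are treated by iteration.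
sum-elem-contains : ∀ {m} {S : Fin m → Bool} (E : Enumeration S) (h : Fin m → ℕ) us →
                    sum (h ∘ Enumeration.elem E) * contains us S ≡
                    sum (λ u → h u * contains (u ∷ us) S)
sum-elem-contains {S = S} E h us = trans (cong (_* contains us S) (Enumeration.sum-elem E h))
  (trans (*-distribʳ-sum (contains us S) (λ u → h u * 𝟙 (S u)))
    (sum-cong-≗ λ u → *-assoc (h u) (𝟙 (S u)) (contains us S)))

module _ {m} {S : Fin m → Bool} (E : Enumeration S) where
  open Enumeration E

  sum₁-elem : (h : Fin m → ℕ) → sum (λ i → h (elem i)) ≡ sum (λ u → h u * contains (u ∷ []) S)
  sum₁-elem h = trans (sym (*-identityʳ _)) (sum-elem-contains E h [])

  sum₂-elem : (h : Fin m → Fin m → ℕ) → sum (λ i → sum λ j → h (elem i) (elem j)) ≡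
              sum (λ u → sum λ v → h u v * contains (v ∷ u ∷ []) S)
  sum₂-elem h = trans (sum₁-elem λ u → sum (h u ∘ elem))
    (sum-cong-≗ λ u → sum-elem-contains E (h u) (u ∷ []))

  sum₃-elem : (h : Fin m → Fin m → Fin m → ℕ) →
              sum (λ i → sum λ j → sum λ l → h (elem i) (elem j) (elem l)) ≡
              sum (λ u → sum λ v → sum λ w → h u v w * contains (w ∷ v ∷ u ∷ []) S)
  sum₃-elem h = trans (sum₂-elem λ u v → sum (h u v ∘ elem))
    (sum-cong-≗ λ u → sum-cong-≗ λ v → sum-elem-contains E (h u v) (v ∷ u ∷ []))

-- Normalised expectations

-- The total weight `(1 + p) ^ m`; being positive, it cancels when two means are compared.
mass : ℕ → ℕ → ℕ
mass p m = 𝔼 p {m} (const 1)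

mass>0 : ∀ p m → 0 < mass p m
mass>0 p zero    = s≤s z≤n
mass>0 p (suc m) = <-≤-trans (mass>0 p m) (m≤n+m _ _)

-- The unscaled expectation of g is x / k.
record Mean (p : ℕ) {m} (k : ℕ) (g : (Fin m → Bool) → ℕ) (x : ℕ) : Set where
  constructor mean
  field
    value : k * 𝔼 p g ≡ x * mass p m

module _ {p m : ℕ} where

  -- Each entry contributes a factor `1 / (1 + p)` by independence. Distinctness matters, since a
  -- repeated entry would contribute only once.
  mean-contains : ∀ {us : List (Fin m)} → Unique us → Mean p (suc p ^ length us) (contains us) 1
  mean-contains {[]}     []           = mean refl
  mean-contains {u ∷ us} (u∉us ∷ uus) = mean (trans
    (solve 3 (λ q k a → q :* k :* a := k :* (q :* a)) refl (suc p) (suc p ^ length us) _)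
    (trans (cong (suc p ^ length us *_) (𝔼-pick p u (contains us) (contains-local us u∉us)))
      (Mean.value (mean-contains uus))))
    where open +-*-Solver

  mean-scale : ∀ {k x} {g : (Fin m → Bool) → ℕ} c → Mean p k g x → Mean p k (λ S → c * g S) (c * x)
  mean-scale {k} {x} {g} c (mean eq) = mean (trans (cong (k *_) (𝔼-* p c g)) (trans
    (solve 3 (λ k c a → k :* (c :* a) := c :* (k :* a)) refl k c (𝔼 p g))
    (trans (cong (c *_) eq) (sym (*-assoc c x (mass p m))))))
    where open +-*-Solver

  mean-sum : ∀ {k l x} {g : Fin l → (Fin m → Bool) → ℕ} → (∀ i → Mean p k (g i) (x i)) →
             Mean p k (λ S → sum λ i → g i S) (sum x)
  mean-sum {k} {l} {x} {g} means = mean (trans (cong (k *_) (𝔼-sum p g))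
    (trans (*-distribˡ-sum k (𝔼 p ∘ g)) (trans (sum-cong-≗ (Mean.value ∘ means))
      (sym (*-distribʳ-sum (mass p m) x)))))

  mean-+ : ∀ {k x y} {g h : (Fin m → Bool) → ℕ} →
           Mean p k g x → Mean p k h y → Mean p k (λ S → g S + h S) (x + y)
  mean-+ {k} {x} {y} {g} {h} (mean eq) (mean eq′) = mean (trans (cong (k *_) (𝔼-+ p g h))
    (trans (*-distribˡ-+ k (𝔼 p g) (𝔼 p h)) (trans (cong₂ _+_ eq eq′) (sym (*-distribʳ-+ (mass p m) x y)))))

  -- Brings means with different powers of `1 + p` to the common denominator that `mean-≤` expects.
  mean-lift : ∀ {k x} {g : (Fin m → Bool) → ℕ} c → Mean p k g x → Mean p (c * k) g (c * x)
  mean-lift {k} {x} {g} c (mean eq) =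
    mean (trans (*-assoc c k (𝔼 p g)) (trans (cong (c *_) eq) (sym (*-assoc c x (mass p m)))))

  -- Covers tuples with repeated entries: their coefficients vanish, so any denominator is correct.
  mean-0 : ∀ {k x} (g : (Fin m → Bool) → ℕ) → x ≡ 0 → Mean p k (λ S → x * g S) x
  mean-0 {k} g refl = mean (trans (cong (k *_) (𝔼-* p 0 g)) (*-zeroʳ k))

  mean-≤ : ∀ {k x y} {g h : (Fin m → Bool) → ℕ} →
           Mean p k g x → Mean p k h y → (∀ S → g S ≤ h S) → x ≤ y
  mean-≤ {k} {x} {y} {g} {h} (mean eq) (mean eq′) g≤h =
    *-cancelʳ-≤ x y (mass p m) {{>-nonZero (mass>0 p m)}} (begin
      x * mass p m ≡⟨ eq ⟨
      k * 𝔼 p g    ≤⟨ *-monoʳ-≤ k (𝔼-mono p g≤h) ⟩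
      k * 𝔼 p h    ≡⟨ eq′ ⟩
      y * mass p m ∎)
    where open ≤-Reasoning

-- Here w blocks the pair (u , v) with multiplicity B u v w, and every S has weight
-- at most c |S| in unblocked pairs.  Sampling with probability 1 / 2t keeps at
-- least half of the expected pairs unblocked.
sampling : ∀ {m} (a : Fin m → Fin m → ℕ) (B : Fin m → Fin m → Fin m → ℕ) c t → 1 ≤ t →
           (∀ u → a u u ≡ 0) → (∀ u v → B u v u ≡ 0) → (∀ u v → B u v v ≡ 0) →
           (∀ u v → sum (B u v) ≤ t * a u v) →
           (∀ S → sum (λ u → sum λ v → a u v * contains (v ∷ u ∷ []) S)
                ≤ c * sum (λ u → 1 * contains (u ∷ []) S)
                  + sum (λ u → sum λ v → sum λ w → B u v w * contains (w ∷ v ∷ u ∷ []) S)) →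
           sum (λ u → sum (a u)) ≤ 4 * c * t * m
sampling {m} a B c t@(suc t-1) _ diag Bu Bv ΣB≤t hyp =
  -- Over the denominator `q ^ 3`, pairs contribute `q * N`, vertices `q * (q * (c * m))` and
  -- triples `N₃`. Since `q` is `t + t` and `N₃` is at most `t * N`, half of the pairs survive.
  *-cancelˡ-≤ t (+-cancelʳ-≤ (t * N) _ _ (begin
    t * N + t * N                      ≡⟨ *-distribʳ-+ N t t ⟨
    q * N                              ≤⟨ mean-≤ lhs rhs hyp ⟩
    q * (q * (c * m)) + N₃             ≤⟨ +-monoʳ-≤ _ N₃≤tN ⟩
    q * (q * (c * m)) + t * N          ≡⟨ cong (_+ t * N) (solve 3 (λ t c m →
        (t :+ t) :* ((t :+ t) :* (c :* m)) := t :* (con 4 :* c :* t :* m)) refl t c m) ⟩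
    t * (4 * c * t * m) + t * N        ∎))
  where
  open ≤-Reasoning
  open +-*-Solver
  p q N N₃ : ℕ
  -- The density `1 / (1 + p)` is then `1 / 2t`, and `q` unfolds to `t + t`.
  p = t-1 + t
  q = suc p
  N = sum λ u → sum (a u)
  N₃ = sum λ u → sum λ v → sum (B u v)

  mean-term : ∀ us x → (x ≡ 0 ⊎ Unique us) → Mean p {m} (q ^ length us) (λ S → x * contains us S) x
  mean-term us x (inj₁ x≡0) = mean-0 (contains us) x≡0
  mean-term us x (inj₂ uus) = subst (Mean p _ _) (*-identityʳ x) (mean-scale x (mean-contains uus))

  pair? : ∀ u v → a u v ≡ 0 ⊎ Unique (v ∷ u ∷ [])
  pair? u v with v ≟ u
  ... | yes refl = inj₁ (diag u)
  ... | no v≢u   = inj₂ ((v≢u ∷ []) ∷ [] ∷ [])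

  B≤ta : ∀ u v w → B u v w ≤ t * a u v
  B≤ta u v w = ≤-trans (term≤sum (B u v) w) (ΣB≤t u v)

  triple? : ∀ u v w → B u v w ≡ 0 ⊎ Unique (w ∷ v ∷ u ∷ [])
  triple? u v w with pair? u v | w ≟ u | w ≟ v
  -- If `u` and `v` coincide, `a u v` is zero, and the bound `ΣB≤t` forces `B u v w` to vanish too.
  ... | inj₁ a≡0 | _ | _ = inj₁ (n≤0⇒n≡0 (≤-trans (B≤ta u v w)
                             (≤-reflexive (trans (cong (t *_) a≡0) (*-zeroʳ t)))))
  ... | _ | yes refl | _ = inj₁ (Bu u v)
  ... | _ | _ | yes refl = inj₁ (Bv u v)
  ... | inj₂ vu | no w≢u | no w≢v = inj₂ ((w≢v ∷ w≢u ∷ []) ∷ vu)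

  lhs : Mean p (q ^ 3) (λ S → sum λ u → sum λ v → a u v * contains (v ∷ u ∷ []) S) (q * N)
  lhs = mean-lift q (mean-sum λ u → mean-sum λ v → mean-term (v ∷ u ∷ []) (a u v) (pair? u v))

  rhs : Mean p (q ^ 3)
    (λ S → c * sum (λ u → 1 * contains (u ∷ []) S)
         + sum λ u → sum λ v → sum λ w → B u v w * contains (w ∷ v ∷ u ∷ []) S)
    (q * (q * (c * m)) + N₃)
  rhs = mean-+
    (mean-lift q (mean-lift q (mean-scale c (subst (Mean p _ _)
      (trans (sum-const m 1) (*-identityʳ m))
      (mean-sum λ u → mean-term (u ∷ []) 1 (inj₂ ([] ∷ [])))))))
    (mean-sum λ u → mean-sum λ v → mean-sum λ w →
      mean-term (w ∷ v ∷ u ∷ []) (B u v w) (triple? u v w))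

  N₃≤tN : N₃ ≤ t * N
  N₃≤tN = begin
    N₃                             ≤⟨ sum-mono (λ u → sum-mono (ΣB≤t u)) ⟩
    sum (λ u → sum λ v → t * a u v) ≡⟨ sum-cong-≗ (λ u → *-distribˡ-sum t (a u)) ⟨
    sum (λ u → t * sum (a u))      ≡⟨ *-distribˡ-sum t (λ u → sum (a u)) ⟨
    t * N                          ∎

-- Adjacency and reachability

∧-true⁻ : ∀ {x y} → x ∧ y ≡ true → x ≡ true × y ≡ true
∧-true⁻ {true} eq = refl , eq

∧-true⁺ : ∀ {x y} → x ≡ true → y ≡ true → x ∧ y ≡ true
∧-true⁺ refl refl = refl

∨-true⁻ : ∀ {x y} → x ∨ y ≡ true → x ≡ true ⊎ y ≡ true
∨-true⁻ {true}  eq = inj₁ refl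
∨-true⁻ {false} eq = inj₂ eq

∨-true⁺ : ∀ {x y} → x ≡ true ⊎ y ≡ true → x ∨ y ≡ true
∨-true⁺ (inj₁ refl) = refl
∨-true⁺ {x} (inj₂ refl) = Bool.∨-zeroʳ x

any-allFin⁻ : ∀ {m} (p : Fin m → Bool) → any p (allFin m) ≡ true → ∃ λ i → p i ≡ true
any-allFin⁻ {m} p eq =
  let i , pᵢ = Any.satisfied (Any.any⁻ p (allFin m) (Equivalence.from Bool.T-≡ eq))
  in i , Equivalence.to Bool.T-≡ pᵢ

any-allFin⁺ : ∀ {m} (p : Fin m → Bool) i → p i ≡ true → any p (allFin m) ≡ true
any-allFin⁺ p i pᵢ =
  Equivalence.to Bool.T-≡ (Any.any⁺ p (lose (∈-allFin i) (Equivalence.from Bool.T-≡ pᵢ)))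

eqᵇ⇒≡ : ∀ {m} {u v : Fin m} → eqᵇ u v ≡ true → u ≡ v
eqᵇ⇒≡ {u = u} {v} eq with u ≟ v
... | yes u≡v = u≡v

eqᵇ-refl : ∀ {m} (u : Fin m) → eqᵇ u u ≡ true
eqᵇ-refl u with u ≟ u
... | yes _  = refl
... | no u≢u = contradiction refl u≢u

adj-sym : ∀ G u v → adj G u v ≡ adj G v u
adj-sym G u v with u ≟ v | v ≟ u
... | yes _   | yes _   = refl
... | yes u≡v | no v≢u  = contradiction (sym u≡v) v≢u
... | no u≢v  | yes v≡u = contradiction (sym v≡u) u≢v
... | no _    | no _    = Bool.∨-comm (edge G u v) (edge G v u)

adj-irrefl : ∀ G u → adj G u u ≡ false
adj-irrefl G u = cong (λ b → not b ∧ (edge G u u ∨ edge G u u)) (eqᵇ-refl u)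

Adj⇒≢ : ∀ G {u v} → Adj G u v → u ≢ v
Adj⇒≢ G {u} Guv refl = contradiction (trans (sym Guv) (adj-irrefl G u)) λ ()

Adj⇒edge : ∀ G {u v} → Adj G u v → edge G u v ≡ true ⊎ edge G v u ≡ true
Adj⇒edge G {u} {v} Guv = ∨-true⁻ (proj₂ (∧-true⁻ {not (eqᵇ u v)} Guv))

edge⇒Adj : ∀ G {u v} → u ≢ v → edge G u v ≡ true ⊎ edge G v u ≡ true → Adj G u v
edge⇒Adj G {u} {v} u≢v e with u ≟ v
... | yes u≡v = contradiction u≡v u≢v
... | no _    = ∨-true⁺ e

module _ (G : Graph) (P : Fin (n G) → Bool) where

  reach-weaken : ∀ k {u v} → reachInB G P k u v ≡ true → reachInB G P (suc k) u v ≡ true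
  reach-weaken k uv = ∨-true⁺ (inj₁ uv)

  reach-cons : ∀ k {u v w} → Adj G u w → P w ≡ true → reachInB G P k w v ≡ true →
               reachInB G P (suc k) u v ≡ true
  reach-cons k {u} {v} {w} uw Pw wv =
    ∨-true⁺ {reachInB G P k u v} (inj₂ (any-allFin⁺ _ w (∧-true⁺ uw (∧-true⁺ Pw wv))))

  reach-uncons : ∀ k {u v} → reachInB G P (suc k) u v ≡ true → reachInB G P k u v ≡ true ⊎
                 ∃ λ w → Adj G u w × P w ≡ true × reachInB G P k w v ≡ true
  reach-uncons k {u} {v} uv with ∨-true⁻ {reachInB G P k u v} uv
  ... | inj₁ uv′  = inj₁ uv′
  ... | inj₂ some with any-allFin⁻ _ some
  ... | w , eq with ∧-true⁻ {adj G u w} eq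
  ... | uw , eq′ with ∧-true⁻ {P w} eq′
  ... | Pw , wv = inj₂ (w , uw , Pw , wv)

  reach-snoc : ∀ k {u v w} → reachInB G P k u v ≡ true → Adj G v w → P w ≡ true →
               reachInB G P (suc k) u w ≡ true
  reach-snoc zero {u} {v} {w} uv vw Pw with refl ← eqᵇ⇒≡ {u = u} {v} uv =
    reach-cons zero vw Pw (eqᵇ-refl w)
  reach-snoc (suc k) uv vw Pw with reach-uncons k uv
  ... | inj₁ uv′              = reach-weaken (suc k) (reach-snoc k uv′ vw Pw)
  ... | inj₂ (x , ux , Px , xv) = reach-cons (suc k) ux Px (reach-snoc k xv vw Pw)

module _ (G : Graph) where

  private
    V : Fin (n G) → Bool
    V _ = true

  dist-refl : ∀ k u → distLe G k u u ≡ true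
  dist-refl zero    u = eqᵇ-refl u
  dist-refl (suc k) u = reach-weaken G V k (dist-refl k u)

  dist-mono : ∀ {k l u v} → k ≤ l → distLe G k u v ≡ true → distLe G l u v ≡ true
  dist-mono {zero} {l} {u} {v} z≤n uv with refl ← eqᵇ⇒≡ {u = u} {v} uv = dist-refl l u
  dist-mono {suc k} {suc l} (s≤s k≤l) uv with reach-uncons G V k uv
  ... | inj₁ uv′               = reach-weaken G V l (dist-mono k≤l uv′)
  ... | inj₂ (w , uw , Pw , wv) = reach-cons G V l uw Pw (dist-mono k≤l wv)

  dist-sym : ∀ k {u v} → distLe G k u v ≡ true → distLe G k v u ≡ true
  dist-sym zero {u} {v} uv with refl ← eqᵇ⇒≡ {u = u} {v} uv = eqᵇ-refl u
  dist-sym (suc k) {u} uv with reach-uncons G V k uv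
  ... | inj₁ uv′               = reach-weaken G V k (dist-sym k uv′)
  ... | inj₂ (w , uw , Pw , wv) =
    reach-snoc G V k (dist-sym k wv) (trans (adj-sym G w u) uw) refl

  dist-trans : ∀ k l {u v w} → distLe G k u v ≡ true → distLe G l v w ≡ true →
               distLe G (k + l) u w ≡ true
  dist-trans zero l {u} {v} uv vw with refl ← eqᵇ⇒≡ {u = u} {v} uv = vw
  dist-trans (suc k) l uv vw with reach-uncons G V k uv
  ... | inj₁ uv′               = reach-weaken G V (k + l) (dist-trans k l uv′ vw)
  ... | inj₂ (x , ux , Px , xv) = reach-cons G V (k + l) ux Px (dist-trans k l xv vw)

  Adj-power⁻ : ∀ d {u v} → Adj (power G d) u v → distLe G d u v ≡ true
  Adj-power⁻ d uv with Adj⇒edge (power G d) uv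
  ... | inj₁ duv = duv
  ... | inj₂ dvu = dist-sym d dvu

  Adj-power⁺ : ∀ d {u v} → u ≢ v → distLe G d u v ≡ true → Adj (power G d) u v
  Adj-power⁺ d u≢v duv = edge⇒Adj (power G d) u≢v (inj₁ duv)

  -- The list index records all visited vertices, both ends included, so that conditions along a
  -- walk can be stated by `All`.
  data Walk : Fin (n G) → Fin (n G) → List (Fin (n G)) → Set where
    stop : ∀ {v} → Walk v v (v ∷ [])
    step : ∀ {u w v xs} → Adj G u w → Walk w v xs → Walk u v (u ∷ xs)

  Between : ℕ → Fin (n G) → Fin (n G) → Fin (n G) → Set
  Between d u v x = ∃ λ k → ∃ λ l → k + l ≤ d × distLe G k x u ≡ true × distLe G l x v ≡ true

  -- While `k` bounds the remaining length, `j` bounds the distance back to the start `u`; the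
  -- invariant `j + k ≤ d` makes each visited vertex satisfy `Between`.
  walk : ∀ {d u} j k {y v} → j + k ≤ d → distLe G j y u ≡ true → distLe G k y v ≡ true →
         ∃ λ xs → Walk y v xs × length xs ≤ suc k × All (Between d u v) xs
  walk j zero {y} {v} j+k≤d yu yv with refl ← eqᵇ⇒≡ {u = y} {v} yv =
    y ∷ [] , stop , ≤-refl , (j , 0 , j+k≤d , yu , yv) ∷ []
  walk j (suc k) {y} {v} j+k≤d yu yv with reach-uncons G V k yv
  ... | inj₁ yv′ =
    let xs , W , len , mid = walk j k (≤-trans (+-monoʳ-≤ j (n≤1+n k)) j+k≤d) yu yv′
    in xs , W , ≤-trans len (n≤1+n _) , mid
  ... | inj₂ (w , yw , _ , wv) =
    let xs , W , len , mid = walk (suc j) k (≤-trans (≤-reflexive (sym (+-suc j k))) j+k≤d)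
                               (reach-cons G V j (trans (adj-sym G w y) yw) refl yu) wv
    in y ∷ xs , step yw W , s≤s len , (j , suc k , j+k≤d , yu , yv) ∷ mid

  -- The first vertex of the walk labelled `b` is entered from one labelled `a`, as no other label
  -- occurs.
  switch : ∀ {A : Set} (f : Fin (n G) → A) {a b u v xs} → Walk u v xs → a ≢ b →
           All (λ x → f x ≡ a ⊎ f x ≡ b) xs → f u ≡ a → f v ≡ b →
           ∃ λ x → ∃ λ y → f x ≡ a × f y ≡ b × Adj G x y
  switch f stop a≢b _ fu fv = contradiction (trans (sym fu) fv) a≢b
  switch f (step {u} {w} uw stop) a≢b _ fu fv = u , w , fu , fv , uw
  switch f (step {u} {w} uw W@(step _ _)) a≢b (_ ∷ ab@(inj₁ fw ∷ _)) fu fv = switch f W a≢b ab fw fv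
  switch f (step {u} {w} uw (step _ _)) a≢b (_ ∷ inj₂ fw ∷ _) fu fv = u , w , fu , fw , uw

-- Voronoi cells

find : ∀ {k} {P : Fin k → Set} → Decidable P → Maybe (Fin k)
find P? with any? P?
... | yes (i , _) = just i
... | no _        = nothing

find-sound : ∀ {k} {P : Fin k → Set} (P? : Decidable P) {i} → find P? ≡ just i → P i
find-sound P? eq with any? P?
find-sound P? refl | yes (_ , Pᵢ) = Pᵢ

find-complete : ∀ {k} {P : Fin k → Set} (P? : Decidable P) {i} → P i → ∃ λ j → find P? ≡ just j
find-complete P? {i} Pᵢ with any? P?
... | yes (j , _) = j , refl
... | no ∄P       = contradiction (i , Pᵢ) ∄P

module Voronoi (G : Graph) {k : ℕ} (c : Fin k → Fin (n G)) where

  attached? : (β : Fin (n G) → Maybe (Fin k)) (x : Fin (n G)) →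
              Decidable λ i → ∃ λ y → Adj G x y × β y ≡ just i
  attached? β x i = any? λ y → (adj G x y Bool.≟ true) ×-dec ≡-dec _≟_ (β y) (just i)

  -- Growing all cells simultaneously makes every vertex join its cell through
  -- a neighbour that joined one round earlier, so cells have radius at most r.
  cell : ℕ → Fin (n G) → Maybe (Fin k)
  cell zero    x = find λ i → c i ≟ x
  cell (suc r) x = cell r x <∣> find (attached? (cell r) x)

  cell-suc : ∀ r {x i} → cell r x ≡ just i → cell (suc r) x ≡ just i
  cell-suc r {x} eq rewrite eq = refl

  cell-suc⁻ : ∀ r {x i} → cell (suc r) x ≡ just i →
              cell r x ≡ just i ⊎ ∃ λ y → Adj G x y × cell r y ≡ just i
  cell-suc⁻ r {x} eq with cell r x
  ... | just _  = inj₁ eq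
  ... | nothing = inj₂ (find-sound (attached? (cell r) x) eq)

  -- The set `P` is left general: it is the branch set when the minor is built, and the whole vertex
  -- set when only the distance to the centre matters.
  cell-reach : ∀ r {P i x} → (∀ {y} → cell r y ≡ just i → P y ≡ true) → cell r x ≡ just i →
               reachInB G P r (c i) x ≡ true
  cell-reach zero {i = i} {x} cell⊆P eq with refl ← find-sound (λ j → c j ≟ x) eq = eqᵇ-refl (c i)
  cell-reach (suc r) {P} {i} {x} cell⊆P eq with cell-suc⁻ r eq
  ... | inj₁ eq′           = reach-weaken G P r (cell-reach r (cell⊆P ∘ cell-suc r) eq′)
  ... | inj₂ (y , xy , eq′) = reach-snoc G P r (cell-reach r (cell⊆P ∘ cell-suc r) eq′)
                               (trans (adj-sym G y x) xy) (cell⊆P eq)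

  cell-near : ∀ r {i x} → cell r x ≡ just i → distLe G r x (c i) ≡ true
  cell-near r eq = dist-sym G r (cell-reach r (const refl) eq)

  -- The cell found may belong to a centre other than `c i`, since `x` joins the first cell to reach
  -- it.
  cell-complete : ∀ r {i x} → distLe G r x (c i) ≡ true → ∃ λ j → cell r x ≡ just j
  cell-complete zero {i} {x} near with refl ← eqᵇ⇒≡ {u = x} {c i} near =
    find-complete (λ j → c j ≟ x) refl
  cell-complete (suc r) {i} {x} near with cell r x in eq
  ... | just j  = j , refl
  ... | nothing with reach-uncons G _ r near
  ...   | inj₁ near′ =
    contradiction (trans (sym eq) (proj₂ (cell-complete r near′))) λ ()
  ...   | inj₂ (y , xy , _ , near′) =
    let j , eq′ = cell-complete r near′ in find-complete (attached? (cell r) x) (y , xy , eq′)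

  cell-centre : Injective _≡_ _≡_ c → ∀ r i → cell r (c i) ≡ just i
  cell-centre inj zero i =
    let j , eq = find-complete (λ j → c j ≟ c i) {i} refl
    in trans eq (cong just (inj (find-sound (λ j → c j ≟ c i) eq)))
  cell-centre inj (suc r) i = cell-suc r (cell-centre inj r i)

  touching? : ∀ r i j → Dec (∃ λ u → ∃ λ v → cell r u ≡ just i × cell r v ≡ just j × Adj G u v)
  touching? r i j = any? λ u → any? λ v →
    ≡-dec _≟_ (cell r u) (just i) ×-dec ≡-dec _≟_ (cell r v) (just j) ×-dec (adj G u v Bool.≟ true)

  voronoi : ℕ → Graph
  voronoi r = record { n = k ; edge = λ i j → ⌊ touching? r i j ⌋ }

  inBranch-cell : ∀ r {i v} → cell r v ≡ just i → inBranch (cell r) i v ≡ true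
  inBranch-cell r {i} eq rewrite eq = eqᵇ-refl i

  voronoi-minor : Injective _≡_ _≡_ c → ∀ r → DepthMinor r (voronoi r) G
  voronoi-minor inj r = cell r , c , cell-centre inj r
    , (λ i v → cell-reach r (inBranch-cell r))
    , λ i j ij → realise (Adj⇒edge (voronoi r) ij)
    where
    touching : ∀ {i j} → edge (voronoi r) i j ≡ true →
               ∃ λ u → ∃ λ v → cell r u ≡ just i × cell r v ≡ just j × Adj G u v
    touching e = toWitness (Equivalence.from Bool.T-≡ e)
    realise : ∀ {i j} → edge (voronoi r) i j ≡ true ⊎ edge (voronoi r) j i ≡ true →
              ∃ λ u → ∃ λ v → cell r u ≡ just i × cell r v ≡ just j × Adj G u v
    realise (inj₁ e) = touching e
    realise (inj₂ e) = let u , v , eu , ev , uv = touching e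
                       in v , u , ev , eu , trans (adj-sym G v u) uv

  -- Every vertex of the walk lies in one of the two cells, so the walk has to
  -- cross directly from the one to the other.
  walk⇒Adj : Injective _≡_ _≡_ c → ∀ r {i j xs} → i ≢ j → Walk G (c i) (c j) xs →
             All (λ x → distLe G r x (c i) ≡ true ⊎ distLe G r x (c j) ≡ true) xs →
             All (λ x → ∀ l → distLe G r x (c l) ≡ true → l ≡ i ⊎ l ≡ j) xs →
             Adj (voronoi r) i j
  walk⇒Adj inj r {i} {j} i≢j W ends only = edge⇒Adj (voronoi r) i≢j (inj₁
    (Equivalence.to Bool.T-≡ (fromWitness
      (switch G (cell r) W (i≢j ∘ just-injective) (All.zipWith assigned (ends , only))
        (cell-centre inj r i) (cell-centre inj r j)))))
    where
    located : ∀ {x l} → cell r x ≡ just l → l ≡ i ⊎ l ≡ j → cell r x ≡ just i ⊎ cell r x ≡ just j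
    located eq (inj₁ refl) = inj₁ eq
    located eq (inj₂ refl) = inj₂ eq
    nonempty : ∀ {x} → distLe G r x (c i) ≡ true ⊎ distLe G r x (c j) ≡ true →
               ∃ λ l → cell r x ≡ just l
    nonempty (inj₁ near) = cell-complete r near
    nonempty (inj₂ near) = cell-complete r near
    assigned : ∀ {x} → (distLe G r x (c i) ≡ true ⊎ distLe G r x (c j) ≡ true) ×
               (∀ l → distLe G r x (c l) ≡ true → l ≡ i ⊎ l ≡ j) →
               cell r x ≡ just i ⊎ cell r x ≡ just j
    assigned (near , only) = let l , eq = nonempty near in located eq (only l (cell-near r eq))

-- `numEdges` counts an edge at its endpoint of larger index, that is, in exactly one of its two
-- orders.
degree-sum≤2*numEdges : ∀ G → sum (λ u → sum λ v → 𝟙 (adj G u v)) ≤ 2 * numEdges G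
degree-sum≤2*numEdges G = ≤-trans (sum-sum-symmetric _ later split) (≤-reflexive (cong (2 *_) (sym (trans
  (sum-map-tabulate (λ u → count (λ v → adj G u v ∧ (toℕ v <ᵇ toℕ u))) id)
  (sum-cong-≗ λ u → count≡sum λ v → adj G u v ∧ (toℕ v <ᵇ toℕ u))))))
  where
  later : Fin (n G) → Fin (n G) → ℕ
  later u v = 𝟙 (adj G u v ∧ (toℕ v <ᵇ toℕ u))
  split : ∀ u v → 𝟙 (adj G u v) ≤ later u v + later v u
  split u v with adj G u v in uv
  ... | false = z≤n
  ... | true with <-cmp (toℕ v) (toℕ u)
  ...   | tri< v<u _ _ rewrite Equivalence.to Bool.T-≡ (<⇒<ᵇ v<u) = s≤s z≤n
  ...   | tri≈ _ v≡u _ = contradiction (sym (toℕ-injective v≡u)) (Adj⇒≢ G uv)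
  ...   | tri> _ _ u<v rewrite trans (adj-sym G v u) uv | Equivalence.to Bool.T-≡ (<⇒<ᵇ u<v) = m≤n+m 1 _

-- Density of induced subgraphs of powers

-- The two inequalities make `ρ` the floor of `d / 2`. The first turns balls of radius `ρ` into
-- cliques; the second puts every vertex of a walk of length at most `d` within `ρ` of an end.
module PowerDensity (G H : Graph) (d ρ ω : ℕ) (2ρ≤d : ρ + ρ ≤ d) (d≤1+2ρ : d ≤ suc (ρ + ρ))
  (f : Fin (n H) → Fin (n G)) (f-injective : Injective _≡_ _≡_ f)
  (f-adj : ∀ u v → adj H u v ≡ adj (power G d) (f u) (f v))
  (cliques≤ω : ∀ k → HasClique H k → k ≤ ω) where

  near : Fin (n G) → Fin (n H) → Bool
  near x w = distLe G ρ x (f w)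

  -- Two distinct vertices of `H` near the same `x` have distance at most `2ρ ≤ d` in `G`, hence are
  -- adjacent in `H`.
  ball≤ω : ∀ x → sum (𝟙 ∘ near x) ≤ ω
  ball≤ω x = ≤-trans (≤-reflexive (sym size≡sum)) (cliques≤ω size (elem , clique))
    where
    open Enumeration (enumerate (near x))
    clique : ∀ i j → i ≢ j → Adj H (elem i) (elem j)
    clique i j i≢j = trans (f-adj (elem i) (elem j)) (Adj-power⁺ G d (i≢j ∘ injective ∘ f-injective)
      (dist-mono G 2ρ≤d (dist-trans G ρ ρ (dist-sym G ρ (sound i)) (sound j))))

  -- The ends are excluded because their own closeness to `x` is harmless: the minor edge sought
  -- joins exactly their cells.
  blocks : Fin (n H) → Fin (n H) → Fin (n G) → Fin (n H) → Bool
  blocks u v x w = not (eqᵇ w u) ∧ not (eqᵇ w v) ∧ near x w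

  blocks≤near : ∀ u v x w → 𝟙 (blocks u v x w) ≤ 𝟙 (near x w)
  blocks≤near u v x w with eqᵇ w u | eqᵇ w v
  ... | true  | _     = z≤n
  ... | false | true  = z≤n
  ... | false | false = ≤-refl

  blocks-left : ∀ u v x → 𝟙 (blocks u v x u) ≡ 0
  blocks-left u v x rewrite eqᵇ-refl u = refl

  blocks-right : ∀ u v x → 𝟙 (blocks u v x v) ≡ 0
  blocks-right u v x rewrite eqᵇ-refl v with eqᵇ v u
  ... | true  = refl
  ... | false = refl

  ¬blocks⇒end : ∀ u v x w → 𝟙 (blocks u v x w) ≡ 0 → near x w ≡ true → w ≡ u ⊎ w ≡ v
  ¬blocks⇒end u v x w eq xw with w ≟ u | w ≟ v
  ... | yes w≡u | _       = inj₁ w≡u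
  ... | no _    | yes w≡v = inj₂ w≡v
  ... | no _    | no _    = contradiction (trans (sym (cong 𝟙 xw)) eq) λ ()

  blockers : Fin (n H) → Fin (n H) → List (Fin (n G)) → Fin (n H) → ℕ
  blockers u v []       w = 0
  blockers u v (x ∷ xs) w = 𝟙 (blocks u v x w) + blockers u v xs w

  sum-blockers : ∀ u v xs → sum (blockers u v xs) ≤ length xs * ω
  sum-blockers u v []       = ≤-reflexive (sum-0 {n H} λ _ → refl)
  sum-blockers u v (x ∷ xs) = ≤-trans
    (≤-reflexive (∑-distrib-+ (𝟙 ∘ blocks u v x) (blockers u v xs)))
    (+-mono-≤ (≤-trans (sum-mono (blocks≤near u v x)) (ball≤ω x)) (sum-blockers u v xs))

  blockers-left : ∀ u v xs → blockers u v xs u ≡ 0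
  blockers-left u v []       = refl
  blockers-left u v (x ∷ xs) = cong₂ _+_ (blocks-left u v x) (blockers-left u v xs)

  blockers-right : ∀ u v xs → blockers u v xs v ≡ 0
  blockers-right u v []       = refl
  blockers-right u v (x ∷ xs) = cong₂ _+_ (blocks-right u v x) (blockers-right u v xs)

  ¬blockers⇒end : ∀ u v xs → All (λ x → ∀ w → blockers u v xs w ≡ 0 → near x w ≡ true → w ≡ u ⊎ w ≡ v) xs
  ¬blockers⇒end u v []       = []
  ¬blockers⇒end u v (x ∷ xs) =
    (λ w eq → ¬blocks⇒end u v x w (m+n≡0⇒m≡0 _ eq)) ∷
    All.map (λ only w eq → only w (m+n≡0⇒n≡0 (𝟙 (blocks u v x w)) eq)) (¬blockers⇒end u v xs)

  -- Otherwise `k` and `l` are both at least `ρ + 1`, and `k + l` is at least `2ρ + 2`, beyond `d`.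
  Between⇒end : ∀ {u v x} → Between G d u v x → distLe G ρ x u ≡ true ⊎ distLe G ρ x v ≡ true
  Between⇒end (k , l , k+l≤d , xu , xv) with k ≤? ρ | l ≤? ρ
  ... | yes k≤ρ | _       = inj₁ (dist-mono G k≤ρ xu)
  ... | no _    | yes l≤ρ = inj₂ (dist-mono G l≤ρ xv)
  ... | no k≰ρ  | no l≰ρ  = contradiction
    (≤-trans (+-mono-≤ (≰⇒> k≰ρ) (≰⇒> l≰ρ)) (≤-trans k+l≤d d≤1+2ρ))
    (<⇒≱ (s≤s (≤-reflexive (sym (+-suc ρ ρ)))))

  -- For w ≠ u , v, B w is the number of vertices of the path that w is near to.
  record Blocking (u v : Fin (n H)) : Set where
    field
      B       : Fin (n H) → ℕ
      B-left  : B u ≡ 0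
      B-right : B v ≡ 0
      sum-B   : sum B ≤ suc d * ω * 𝟙 (adj H u v)
      path    : Adj H u v → ∃ λ xs → Walk G (f u) (f v) xs
                × All (λ x → near x u ≡ true ⊎ near x v ≡ true) xs
                × All (λ x → ∀ w → B w ≡ 0 → near x w ≡ true → w ≡ u ⊎ w ≡ v) xs

  blocking : ∀ u v → Blocking u v
  blocking u v with adj H u v in uv
  -- For a non-adjacent pair the right-hand side of `sum-B` is zero, so there must be no blockers.
  ... | false = record
    { B = const 0 ; B-left = refl ; B-right = refl
    ; sum-B = ≤-trans (≤-reflexive (sum-0 {n H} λ _ → refl)) z≤n
    ; path = λ uv′ → contradiction (trans (sym uv) uv′) λ () }
  ... | true =
    -- The walk has at most `suc d` vertices, each near to at most `ω` vertices of `H`.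
    let xs , W , len , mid = walk G 0 d ≤-refl (eqᵇ-refl (f u))
                               (Adj-power⁻ G d (trans (sym (f-adj u v)) uv))
    in record
    { B = blockers u v xs ; B-left = blockers-left u v xs ; B-right = blockers-right u v xs
    ; sum-B = ≤-trans (sum-blockers u v xs) (≤-trans (*-monoˡ-≤ ω len)
        (≤-reflexive (sym (trans (cong (λ b → suc d * ω * 𝟙 b) uv) (*-identityʳ _)))))
    ; path = λ _ → xs , W , All.map Between⇒end mid , ¬blockers⇒end u v xs }

  open Blocking

  degree-sum : ∀ b → 1 ≤ ω → (∀ M → DepthMinor ρ M G → numEdges M ≤ b * n M) →
               sum (λ u → sum λ v → 𝟙 (adj H u v)) ≤ 8 * b * (suc d * ω) * n H
  degree-sum b 1≤ω minors = ≤-trans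
    -- The factor `2 * b` bounds the average degree of the minors, and `suc d * ω` bounds the
    -- blockers of a pair; `1 ≤ ω` makes the latter positive.
    (sampling a (λ u v → B (blocking u v)) (2 * b) (suc d * ω) (≤-trans 1≤ω (m≤m+n ω (d * ω)))
      (λ u → cong 𝟙 (adj-irrefl H u)) (λ u v → B-left (blocking u v)) (λ u v → B-right (blocking u v))
      (λ u v → sum-B (blocking u v)) sample)
    (≤-reflexive (cong (λ x → x * (suc d * ω) * n H) (sym (*-assoc 4 2 b))))
    where
    a : Fin (n H) → Fin (n H) → ℕ
    a u v = 𝟙 (adj H u v)

    sample : ∀ S → sum (λ u → sum λ v → a u v * contains (v ∷ u ∷ []) S)
                 ≤ 2 * b * sum (λ u → 1 * contains (u ∷ []) S)
                   + sum (λ u → sum λ v → sum λ w → B (blocking u v) w * contains (w ∷ v ∷ u ∷ []) S)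
    sample S = begin
      sum (λ u → sum λ v → a u v * contains (v ∷ u ∷ []) S)
        ≡⟨ sum₂-elem E a ⟨
      sum (λ i → sum λ j → a (elem i) (elem j))
        ≤⟨ sum-mono (λ i → sum-mono (unblocked i)) ⟩
      sum (λ i → sum λ j → 𝟙 (adj M i j) + blocked i j)
        ≡⟨ sum-cong-≗ (λ i → ∑-distrib-+ (λ j → 𝟙 (adj M i j)) (blocked i)) ⟩
      sum (λ i → sum (λ j → 𝟙 (adj M i j)) + sum (blocked i))
        ≡⟨ ∑-distrib-+ (λ i → sum λ j → 𝟙 (adj M i j)) (λ i → sum (blocked i)) ⟩
      sum (λ i → sum λ j → 𝟙 (adj M i j)) + sum (λ i → sum (blocked i))
        ≤⟨ +-monoˡ-≤ _ edges≤ ⟩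
      2 * b * size + sum (λ i → sum (blocked i))
        ≡⟨ cong₂ (λ x y → 2 * b * x + y) size≡ (sum₃-elem E λ u v w → B (blocking u v) w) ⟩
      2 * b * sum (λ u → 1 * contains (u ∷ []) S)
        + sum (λ u → sum λ v → sum λ w → B (blocking u v) w * contains (w ∷ v ∷ u ∷ []) S) ∎
      where
      open ≤-Reasoning
      E : Enumeration S
      E = enumerate S
      open Enumeration E
      open Voronoi G (f ∘ elem)

      M : Graph
      M = voronoi ρ

      blocked : Fin size → Fin size → ℕ
      blocked i j = sum λ l → B (blocking (elem i) (elem j)) (elem l)

      -- If a sampled vertex blocks the pair, `blocked i j` already pays for it. Otherwise the two
      -- ends are the only sampled vertices near the chosen walk, and their cells touch.
      unblocked : ∀ i j → a (elem i) (elem j) ≤ 𝟙 (adj M i j) + blocked i j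
      unblocked i j with blocked i j in none
      ... | suc x = ≤-trans (𝟙≤1 _) (≤-trans (s≤s z≤n) (m≤n+m (suc x) _))
      ... | zero  = ≤-trans (𝟙-mono adjacent) (m≤m+n _ 0)
        where
        adjacent : Adj H (elem i) (elem j) → Adj M i j
        adjacent ij =
          let xs , W , ends , only = path (blocking (elem i) (elem j)) ij
          in walk⇒Adj (injective ∘ f-injective) ρ (λ i≡j → Adj⇒≢ H ij (cong elem i≡j)) W ends
               (All.map (λ o l xl → Sum.map injective injective
                 (o (elem l) (sum≡0 _ none l) xl)) only)

      size≡ : size ≡ sum (λ u → 1 * contains (u ∷ []) S)
      size≡ = trans (sym (trans (sum-const size 1) (*-identityʳ size))) (sum₁-elem E (const 1))

      edges≤ : sum (λ i → sum λ j → 𝟙 (adj M i j)) ≤ 2 * b * size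
      edges≤ = ≤-trans (degree-sum≤2*numEdges M) (≤-trans
        (*-monoʳ-≤ 2 (minors M (voronoi-minor (injective ∘ f-injective) ρ)))
        (≤-reflexive (sym (*-assoc 2 b size))))

-- Vertex orderings

induced : (H : Graph) {m : ℕ} → (Fin m → Fin (n H)) → Graph
induced H {m} e = record { n = m ; edge = λ i j → adj H (e i) (e j) }

adj-induced : ∀ H {m} {e : Fin m → Fin (n H)} → Injective _≡_ _≡_ e →
              ∀ i j → adj (induced H e) i j ≡ adj H (e i) (e j)
adj-induced H {e = e} e-inj i j with i ≟ j
... | yes refl = sym (adj-irrefl H (e i))
... | no _     = trans (cong (adj H (e i) (e j) ∨_) (adj-sym H (e j) (e i))) (Bool.∨-idem _)

backDeg≡sum : ∀ H σ u → backDeg H σ u ≡ sum λ v → 𝟙 (adj H u v ∧ (toℕ (σ v) <ᵇ toℕ (σ u)))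
backDeg≡sum H σ u = count≡sum λ v → adj H u v ∧ (toℕ (σ v) <ᵇ toℕ (σ u))

-- Placed at the end, `u` is an earlier neighbour of no vertex, and comparisons among the others are
-- unchanged.
module InsertLast {m : ℕ} (u : Fin (suc m)) (σ : Fin m → Fin m) where

  insertLast : Fin (suc m) → Fin (suc m)
  insertLast v with u ≟ v
  ... | yes _  = fromℕ m
  ... | no u≢v = inject₁ (σ (punchOut u≢v))

  insertLast-new : insertLast u ≡ fromℕ m
  insertLast-new with u ≟ u
  ... | yes _  = refl
  ... | no u≢u = contradiction refl u≢u

  insertLast-old : ∀ i → insertLast (punchIn u i) ≡ inject₁ (σ i)
  insertLast-old i with u ≟ punchIn u i
  ... | yes u≡i = contradiction (sym u≡i) (punchInᵢ≢i u i)
  ... | no u≢i  = cong (inject₁ ∘ σ) (trans (punchOut-cong u refl) (punchOut-punchIn u))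

  data View : Fin (suc m) → Set where
    new : View u
    old : ∀ i → View (punchIn u i)

  view : ∀ v → View v
  view v with u ≟ v
  ... | yes refl = new
  ... | no u≢v   = subst View (punchIn-punchOut u≢v) (old (punchOut u≢v))

  insertLast-injective : Injective _≡_ _≡_ σ → Injective _≡_ _≡_ insertLast
  insertLast-injective σ-inj {v} {w} eq with view v | view w
  ... | new   | new   = refl
  ... | new   | old j =
    contradiction (trans (sym insertLast-new) (trans eq (insertLast-old j))) fromℕ≢inject₁
  ... | old i | new   =
    contradiction (sym (trans (sym (insertLast-old i)) (trans eq insertLast-new))) fromℕ≢inject₁
  ... | old i | old j = cong (punchIn u) (σ-inj (inject₁-injective
    (trans (sym (insertLast-old i)) (trans eq (insertLast-old j)))))

  insertLast-old-new : ∀ i → (toℕ (insertLast u) <ᵇ toℕ (insertLast (punchIn u i))) ≡ false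
  insertLast-old-new i rewrite insertLast-new | insertLast-old i | toℕ-fromℕ m | toℕ-inject₁ (σ i) =
    Bool.¬-not λ m<σᵢ → <-asym (toℕ<n (σ i)) (<ᵇ⇒< m _ (Equivalence.from Bool.T-≡ m<σᵢ))

  insertLast-old-old : ∀ i j → (toℕ (insertLast (punchIn u j)) <ᵇ toℕ (insertLast (punchIn u i)))
                             ≡ (toℕ (σ j) <ᵇ toℕ (σ i))
  insertLast-old-old i j
    rewrite insertLast-old i | insertLast-old j | toℕ-inject₁ (σ i) | toℕ-inject₁ (σ j) = refl

module _ (P : Graph → Set) (D : ℕ)
  (hereditary : ∀ {H m} {e : Fin m → Fin (n H)} → Injective _≡_ _≡_ e → P H → P (induced H e))
  (sparse : ∀ {H} → P H → sum (λ u → sum λ v → 𝟙 (adj H u v)) ≤ D * n H) where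

  -- Sparsity yields a vertex of degree at most `D`; it goes last and the rest is ordered
  -- recursively, as `P` is hereditary. The vertex count `m` is a separate argument to make the
  -- recursion structural.
  degenerate : ∀ m (E : Fin m → Fin m → Bool) → let H = record { n = m ; edge = E } in P H →
               ∃ λ σ → Injective _≡_ _≡_ σ × ColLe H σ (suc D)
  degenerate zero    E PH = id , id , λ ()
  degenerate (suc m) E PH =
    let u , deg≤D      = minimum≤mean (λ u → sum λ v → 𝟙 (adj H u v)) D
                           (≤-trans (sparse PH) (≤-reflexive (*-comm D (suc m))))
        σ , σ-inj , σ≤ = degenerate m _ (hereditary (punchIn-injective u _ _) PH)
    in InsertLast.insertLast u σ , InsertLast.insertLast-injective u σ σ-inj , bound u deg≤D σ σ≤
    where
    H : Graph
    H = record { n = suc m ; edge = E }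

    module _ (u : Fin (suc m)) (deg≤D : sum (λ v → 𝟙 (adj H u v)) ≤ D) (σ : Fin m → Fin m)
      (σ≤ : ColLe (induced H (punchIn u)) σ (suc D)) where
      open InsertLast u σ

      bound : ColLe H insertLast (suc D)
      bound v with view v
      ... | new = s≤s (begin
        backDeg H insertLast u ≡⟨ backDeg≡sum H insertLast u ⟩
        sum (λ v → 𝟙 (adj H u v ∧ (toℕ (insertLast v) <ᵇ toℕ (insertLast u))))
          ≤⟨ sum-mono (λ v → 𝟙-∧≤ (adj H u v) (toℕ (insertLast v) <ᵇ toℕ (insertLast u))) ⟩
        sum (λ v → 𝟙 (adj H u v)) ≤⟨ deg≤D ⟩
        D ∎)
        where open ≤-Reasoning
      -- The vertex `u` comes later and drops out of the sum, leaving the back degree in the graph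
      -- without `u`.
      ... | old i = ≤-trans (s≤s (≤-reflexive (begin
        backDeg H insertLast (punchIn u i)
          ≡⟨ backDeg≡sum H insertLast (punchIn u i) ⟩
        sum back
          ≡⟨ sum-remove {i = u} back ⟩
        back u + sum (back ∘ punchIn u)
          ≡⟨ cong (λ b → 𝟙 b + sum (back ∘ punchIn u)) (trans
               (cong (adj H (punchIn u i) u ∧_) (insertLast-old-new i)) (Bool.∧-zeroʳ _)) ⟩
        sum (back ∘ punchIn u)
          ≡⟨ sum-cong-≗ (λ j → cong 𝟙 (cong₂ _∧_
               (sym (adj-induced H (punchIn-injective u _ _) i j)) (insertLast-old-old i j))) ⟩
        sum (λ j → 𝟙 (adj H′ i j ∧ (toℕ (σ j) <ᵇ toℕ (σ i))))
          ≡⟨ backDeg≡sum H′ σ i ⟨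
        backDeg H′ σ i ∎))) (σ≤ i)
        where
        open ≡-Reasoning
        H′ : Graph
        H′ = induced H (punchIn u)
        back : Fin (suc m) → ℕ
        back v = 𝟙 (adj H (punchIn u i) v ∧ (toℕ (insertLast v) <ᵇ toℕ (insertLast (punchIn u i))))

-- Colourings

-- Pigeonhole: if every colour occurred on `p`, choosing a vertex of each colour would inject the
-- `l` colours into fewer than `l` vertices.
free-colour : ∀ {m l} (p : Fin m → Bool) (col : Fin m → Fin l) → count p < l →
              ∃ λ a → ∀ v → p v ≡ true → col v ≢ a
free-colour p col count<l 
  with any? (λ a → ¬? (any? λ i → col (Enumeration.elem (enumerate p) i) ≟ a))
... | yes (a , unused) = a , λ v pᵥ colᵥ≡a →
  let i , eq = Enumeration.complete (enumerate p) pᵥ in unused (i , trans (cong col eq) colᵥ≡a)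
... | no all-used = contradiction (injective⇒≤ preimage-injective)
  (<⇒≱ (≤-<-trans (≤-reflexive (trans size≡sum (sym (count≡sum p)))) count<l))
  where
  open Enumeration (enumerate p)
  used : ∀ a → ∃ λ i → col (elem i) ≡ a
  used a = decidable-stable (any? λ i → col (elem i) ≟ a) λ unused → all-used (a , unused)
  preimage-injective : Injective _≡_ _≡_ (proj₁ ∘ used)
  preimage-injective {a} {b} eq =
    trans (sym (proj₂ (used a))) (trans (cong (col ∘ elem) eq) (proj₂ (used b)))

module _ (H : Graph) {l : ℕ} (σ : Fin (n H) → Fin (n H))
  (σ-injective : Injective _≡_ _≡_ σ) (σ≤l : ColLe H σ l) where

  ProperBelow : ℕ → (Fin (n H) → Fin l) → Set
  ProperBelow q col = ∀ u v → toℕ (σ u) < q → toℕ (σ v) < q → Adj H u v → col u ≢ col v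

  -- Vertices are coloured in the order `σ`; the values of `col` at positions from `q` on are
  -- placeholders.
  greedy : ∀ q → ∃ (ProperBelow q)
  -- Any vertex `u` witnesses `1 ≤ l` through `σ≤l u`, so colour zero exists.
  greedy zero = (λ u → fromℕ< (≤-trans (s≤s z≤n) (σ≤l u))) , λ _ _ ()
  greedy (suc q) with greedy q | any? (λ u → toℕ (σ u) ≟ℕ q)
  ... | col , proper | no ∄q = col , λ u v u≤q v≤q → proper u v (below u u≤q) (below v v≤q)
    where
    below : ∀ u → toℕ (σ u) < suc q → toℕ (σ u) < q
    below u (s≤s u≤q) = ≤∧≢⇒< u≤q λ u≡q → ∄q (u , u≡q)
  -- The vertex `u₀` at position `q` has fewer than `l` earlier neighbours, so some colour is free
  -- for it.
  ... | col , proper | yes (u₀ , refl)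
    with free-colour (λ v → adj H u₀ v ∧ (toℕ (σ v) <ᵇ toℕ (σ u₀))) col (σ≤l u₀)
  ...   | a , free = col′ , proper′
    where
    col′ : Fin (n H) → Fin l
    col′ v with v ≟ u₀
    ... | yes _ = a
    ... | no _  = col v

    below : ∀ {u} → u ≢ u₀ → toℕ (σ u) < suc (toℕ (σ u₀)) → toℕ (σ u) < toℕ (σ u₀)
    below u≢u₀ (s≤s u≤u₀) = ≤∧≢⇒< u≤u₀ (u≢u₀ ∘ σ-injective ∘ toℕ-injective)

    avoids : ∀ v → v ≢ u₀ → toℕ (σ v) < suc (toℕ (σ u₀)) → Adj H u₀ v → col v ≢ a
    avoids v v≢u₀ v≤u₀ u₀v =
      free v (∧-true⁺ u₀v (Equivalence.to Bool.T-≡ (<⇒<ᵇ (below v≢u₀ v≤u₀))))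

    proper′ : ProperBelow (suc (toℕ (σ u₀))) col′
    proper′ u v u≤ v≤ uv with u ≟ u₀ | v ≟ u₀
    ... | yes refl | yes refl = contradiction refl (Adj⇒≢ H uv)
    ... | yes refl | no v≢u₀  = avoids v v≢u₀ v≤ uv ∘ sym
    ... | no u≢u₀  | yes refl = avoids u u≢u₀ u≤ (trans (adj-sym H v u) uv)
    ... | no u≢u₀  | no v≢u₀  = proper u v (below u≢u₀ u≤) (below v≢u₀ v≤) uv

  ColLe⇒Colorable : Colorable H l
  ColLe⇒Colorable =
    let col , proper = greedy (n H) in col , λ u v → proper u v (toℕ<n (σ u)) (toℕ<n (σ v))

-- A proper colouring is injective on a clique.
clique≤colours : ∀ H {w x} → HasClique H w → Colorable H x → w ≤ x
clique≤colours H (f , clique) (col , proper) = injective⇒≤ {f = col ∘ f} λ {i} {j} eq →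
  decidable-stable (i ≟ j) λ i≢j → proper (f i) (f j) (clique i j i≢j) eq

-- Orderings of graph powers and comparison of the invariants

n≤1+⌊n/2⌋+⌊n/2⌋ : ∀ m → m ≤ suc (⌊ m /2⌋ + ⌊ m /2⌋)
n≤1+⌊n/2⌋+⌊n/2⌋ zero          = z≤n
n≤1+⌊n/2⌋+⌊n/2⌋ (suc zero)    = ≤-refl
n≤1+⌊n/2⌋+⌊n/2⌋ (suc (suc m)) =
  s≤s (≤-trans (s≤s (n≤1+⌊n/2⌋+⌊n/2⌋ m)) (≤-reflexive (cong suc (sym (+-suc _ _)))))

⌊n/2⌋+⌊n/2⌋≤n : ∀ m → ⌊ m /2⌋ + ⌊ m /2⌋ ≤ m
⌊n/2⌋+⌊n/2⌋≤n m = ≤-trans (+-monoʳ-≤ ⌊ m /2⌋ (⌊n/2⌋≤⌈n/2⌉ m)) (≤-reflexive (⌊n/2⌋+⌈n/2⌉≡n m))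

-- Being induced in the power and having no clique larger than `ω` both pass to induced subgraphs,
-- so the density bound holds with the same constant throughout the degeneracy argument.
power-ordering : ∀ G d b ω → 1 ≤ ω → (∀ M → DepthMinor ⌊ d /2⌋ M G → numEdges M ≤ b * n M) →
                 ∀ H → InducedSub H (power G d) → (∀ k → HasClique H k → k ≤ ω) →
                 ∃ λ σ → Injective _≡_ _≡_ σ × ColLe H σ (suc (8 * b * (suc d * ω)))
power-ordering G d b ω 1≤ω minors H H⊆Gᵈ cliques≤ω =
  degenerate P (8 * b * (suc d * ω)) (λ {H} → hereditary {H}) (λ {H} → sparse {H})
    (n H) (edge H) (H⊆Gᵈ , cliques≤ω)
  where
  P : Graph → Set
  P H = InducedSub H (power G d) × (∀ k → HasClique H k → k ≤ ω)

  hereditary : ∀ {H m} {e : Fin m → Fin (n H)} → Injective _≡_ _≡_ e → P H → P (induced H e)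
  hereditary {H} {e = e} e-inj ((f , f-inj , f-adj) , cliques≤ω) =
    (f ∘ e , e-inj ∘ f-inj , λ i j → trans (adj-induced H e-inj i j) (f-adj (e i) (e j)))
    , λ k (g , clique) → cliques≤ω k
        (e ∘ g , λ i j i≢j → trans (sym (adj-induced H e-inj (g i) (g j))) (clique i j i≢j))

  sparse : ∀ {H} → P H → sum (λ u → sum λ v → 𝟙 (adj H u v)) ≤ 8 * b * (suc d * ω) * n H
  sparse {H} ((f , f-inj , f-adj) , cliques≤ω) =
    PowerDensity.degree-sum G H d ⌊ d /2⌋ ω (⌊n/2⌋+⌊n/2⌋≤n d) (n≤1+⌊n/2⌋+⌊n/2⌋ d)
      f f-inj f-adj cliques≤ω b 1≤ω minors

theorem5p1 : ∀ (C : Class) → BoundedExpansion C → ∀ (d : ℕ) →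
    ∃ λ (c : ℕ) → 1 ≤ c ×
    (∀ H → HerPow C d H → ∀ w x l →
    IsCliqueNumber H w → IsChromaticNumber H x → IsColoringNumber H l →
    l ≤ c * w × w ≤ x × x ≤ l)
theorem5p1 C bounded d with bounded ⌊ d /2⌋
-- The outer `suc` makes room for the additive one in the coloring number, which is at most `w` once
-- `w` is positive.
... | b , minors = suc (8 * b * suc d) , s≤s z≤n ,
  λ { H (G , G∈C , H⊆Gᵈ) w x l (clique , cliques≤w) (colours , x≤) ((σ , σ-inj , σ≤l) , l≤) →
      col≤ H G G∈C H⊆Gᵈ w l cliques≤w l≤
    , clique≤colours H clique colours
    , x≤ l (ColLe⇒Colorable H σ σ-inj σ≤l) }
  where
  col≤ : ∀ H G → C G → InducedSub H (power G d) → ∀ w l → (∀ k → HasClique H k → k ≤ w) →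
         (∀ j σ → Injective _≡_ _≡_ σ → ColLe H σ j → l ≤ j) → l ≤ suc (8 * b * suc d) * w
  -- A single vertex would be a clique of size one, so `H` is empty and any ordering gives the bound
  -- `0`.
  col≤ H G G∈C H⊆Gᵈ zero l cliques≤w l≤ = ≤-trans
    (l≤ 0 id id λ u → contradiction
      (cliques≤w 1 (const u , λ { zero zero 0≢0 → contradiction refl 0≢0 })) λ ())
    z≤n
  col≤ H G G∈C H⊆Gᵈ w@(suc _) l cliques≤w l≤ =
    let σ , σ-inj , σ≤ = power-ordering G d b w (s≤s z≤n) (minors G G∈C) H H⊆Gᵈ cliques≤w
    in ≤-trans (l≤ _ σ σ-inj σ≤)
         (+-mono-≤ (s≤s z≤n) (≤-reflexive (sym (*-assoc (8 * b) (suc d) w))))
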